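{- There is a deterministic distributed algorithm in the LOCAL model that finds a maximal half-integral matching in every graph of maximum degree at most $3$ in $O(1)$ rounds (i.e. the number of rounds is bounded by a constant independent of the input graph).
   Context: Fractional matching: for a finite simple graph $G=(V,E)$ and $x\colon E\to[0,1]$, write $x[v]=\sum_{e\in E: v\in e} x(e)$ for $v \in V$. The function $x$ is a fractional matching if $x[v]\le 1$ for all $v\in V$; it is a maximal fractional matching if in addition for every edge $\{u,v\}\in E$ at least one endpoint is saturated, i.e. $x[u]=1$ or $x[v]=1$. A maximal half-integral matching is a maximal fractional matching $x$ with $x(e)\in\{0,\frac12,1\}$ for every $e\in E$. PN (port-numbering) model: each node of the input graph $G$ is a computer and each edge is a communication link. An adversary chooses a port numbering: each node $v$ of degree $\deg(v)$ refers to its incident edges by the numbers $1,\dotsc,\deg(v)$. Initially each node knows only its degree (and the global maximum degree bound), and nodes of the same degree start in the same state. Computation is deterministic and proceeds in synchronous rounds; in each round each node sends a message (of arbitrary size) through each port, receives a message from each port, and updates its state by arbitrary local computation as a function of its current state and the received messages. A node may stop after any number of rounds and announce its local output, here the value $x(e)$ of each incident edge $e$ (the two endpoints of an edge must announce the same value). The running time is the number of rounds until all nodes have stopped. An algorithm must be correct for every input graph in the family and every port numbering. LOCAL model: the same as the PN model, except that each node is additionally given as input a unique identifier, chosen by an adversary from a set of size polynomial in $n=|V|$, e.g. $\{1,\dotsc,n^c\}$ for a fixed constant $c \ge 1$. An algorithm must be correct for every choice of unique identifiers. -}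

module Defs where

open import Algebra.Bundles using (CommutativeMonoid)
open import Data.Bool using (Bool; T)
open import Data.Bool.Properties using (T?)
open import Data.Fin using (Fin)
open import Data.Fin.Subset using (Subset; ∣_∣)
open import Data.Maybe using (Maybe; just; nothing)
open import Data.Nat as ℕ using (ℕ; zero; suc)
open import Data.Product using (∃-syntax; Σ-syntax; _×_; _,_; proj₁; proj₂)
open import Data.Rational using (ℚ; 0ℚ; 1ℚ; ½; _≤_)
open import Data.Rational.Properties using (+-0-commutativeMonoid)
open import Data.Sum using (_⊎_)
open import Data.Vec using (tabulate)
open import Function using (_↔_; module Inverse)
open import Function.Definitions using (Injective)
open import Relation.Binary.PropositionalEquality using (_≡_)
open import Relation.Nullary using (¬_; Dec; yes; no)

import Algebra.Properties.Monoid.Sum (CommutativeMonoid.monoid +-0-commutativeMonoid) as ℚSum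

record Graph (n : ℕ) : Set where
  field
    adjacent : Fin n → Fin n → Bool

  infix 4 _~_
  _~_ : Fin n → Fin n → Set
  u ~ v = T (adjacent u v)

  field
    ~-sym    : ∀ {u v} → u ~ v → v ~ u
    ~-irrefl : ∀ {v} → ¬ (v ~ v)

  neighbours : Fin n → Subset n
  neighbours v = tabulate (adjacent v)

  degree : Fin n → ℕ
  degree v = ∣ neighbours v ∣

MaxDegree≤ : ∀ {n} → ℕ → Graph n → Set
MaxDegree≤ Δ G = ∀ v → Graph.degree G v ℕ.≤ Δ

-- A function E → ℚ.  An undirected edge {u,v} is seen through its two
-- orientations u ~ v and v ~ u, which must carry the same value.
-- Rational values suffice because only the values 0, ½ and 1 matter here.
record EdgeFunction {n} (G : Graph n) : Set where
  open Graph G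
  field
    value     : ∀ {u v} → u ~ v → ℚ
    value-sym : ∀ {u v} (e : u ~ v) → value (~-sym e) ≡ value e

module _ {n} {G : Graph n} (x : EdgeFunction G) where
  open Graph G
  open EdgeFunction x

  valueOr0 : ∀ {u v} → Dec (u ~ v) → ℚ
  valueOr0 (yes e) = value e
  valueOr0 (no _)  = 0ℚ

  -- x[v].  The graph is simple, so the edges at v correspond to the
  -- neighbours of v.
  load : Fin n → ℚ
  load v = ℚSum.sum (λ u → valueOr0 (T? (adjacent v u)))

  Saturated : Fin n → Set
  Saturated v = load v ≡ 1ℚ

  record IsFractionalMatching : Set where
    field
      value≥0 : ∀ {u v} (e : u ~ v) → 0ℚ ≤ value e
      value≤1 : ∀ {u v} (e : u ~ v) → value e ≤ 1ℚ
      load≤1  : ∀ v → load v ≤ 1ℚ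

  record IsMaximalFractionalMatching : Set where
    field
      isFractionalMatching : IsFractionalMatching
      maximal              : ∀ {u v} → u ~ v → Saturated u ⊎ Saturated v

  record IsMaximalHalfIntegralMatching : Set where
    field
      isMaximalFractionalMatching : IsMaximalFractionalMatching
      halfIntegral : ∀ {u v} (e : u ~ v) →
                     value e ≡ 0ℚ ⊎ value e ≡ ½ ⊎ value e ≡ 1ℚ

-- Ports are numbered from 0 rather than from 1.
PortNumbering : ∀ {n} → Graph n → Set
PortNumbering G = ∀ v → Fin (degree v) ↔ (∃[ u ] v ~ u)
  where open Graph G

-- Identifiers drawn from {1, …, n ^ c}.
record Identifiers (c n : ℕ) : Set where
  field
    id        : Fin n → ℕ
    id≥1      : ∀ v → 1 ℕ.≤ id v
    id≤n^c    : ∀ v → id v ℕ.≤ n ℕ.^ c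
    injective : Injective _≡_ _≡_ id

-- An algorithm in the LOCAL model whose output is one label per incident
-- edge.  A node has access to its degree d, its identifier and the messages
-- it receives, and to nothing else about the graph; in particular n is not
-- given.  A degree bound known to all nodes needs no argument of its own:
-- the algorithm is chosen after the bound.
record Algorithm (Label : Set) : Set₁ where
  field
    State   : (d : ℕ) → Set
    Message : Set
    init    : (d : ℕ) (identifier : ℕ) → State d
    send    : ∀ {d} → State d → Fin d → Message
    receive : ∀ {d} → State d → (Fin d → Message) → State d
    -- A node has stopped when this is  just output.
    output  : ∀ {d} → State d → Maybe (Fin d → Label)

  -- A stopped node never changes its state, hence neither its output nor
  -- the messages that its still running neighbours get from it.
  step : ∀ {d} → State d → (Fin d → Message) → State d
  step s m with output s
  ... | just _  = s
  ... | nothing = receive s m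

module Execution {Label : Set} (A : Algorithm Label)
                 {n} (G : Graph n) (p : PortNumbering G)
                 {c} (ids : Identifiers c n) where
  open Algorithm A
  open Graph G

  neighbour : ∀ v → Fin (degree v) → Fin n
  neighbour v i = proj₁ (Inverse.to (p v) i)

  edge : ∀ v (i : Fin (degree v)) → v ~ neighbour v i
  edge v i = proj₂ (Inverse.to (p v) i)

  -- The port at the other end of the edge at port i of v.
  oppositePort : ∀ v (i : Fin (degree v)) → Fin (degree (neighbour v i))
  oppositePort v i = Inverse.from (p (neighbour v i)) (v , ~-sym (edge v i))

  state : (t : ℕ) (v : Fin n) → State (degree v)
  state zero    v = init (degree v) (Identifiers.id ids v)
  state (suc t) v = step (state t v)
    (λ i → send (state t (neighbour v i)) (oppositePort v i))

-- Within t rounds every node has stopped and announced the value x(e) of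
-- each of its incident edges e; in particular, endpoints agree.
AnnouncesWithin : ℕ → Algorithm ℚ → ∀ {n} (G : Graph n) → PortNumbering G →
                  ∀ {c} → Identifiers c n → EdgeFunction G → Set
AnnouncesWithin t A G p ids x =
  ∀ v → ∃[ o ] (output (state t v) ≡ just o × (∀ i → o i ≡ value (edge v i)))
  where
  open Algorithm A
  open Execution A G p ids
  open EdgeFunction x

-- With identifiers from {1, …, n ^ c}, the algorithm A finds a maximal
-- half-integral matching within t rounds in every graph of maximum degree
-- at most Δ.
FindsMaximalHalfIntegralMatching : (c Δ t : ℕ) → Algorithm ℚ → Set
FindsMaximalHalfIntegralMatching c Δ t A =
  ∀ {n} (G : Graph n) → MaxDegree≤ Δ G →
  (p : PortNumbering G) (ids : Identifiers c n) →
  Σ[ x ∈ EdgeFunction G ]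
    (IsMaximalHalfIntegralMatching x × AnnouncesWithin t A G p ids x)

{-# OPTIONS --safe #-}
-- Orient every edge towards its larger identifier.  In a graph of maximum
-- degree 3, at most one edge at a node v disagrees with the majority
-- orientation at v; colour v by that majority and by the port number at the far
-- end of the disagreeing edge.  If v and a neighbour u reached through port i
-- have the same colour and the edge agrees with the majority at v, then it
-- disagrees with the majority at u, so that i itself is the second component of
-- the common colour.  Hence v has at most one such edge, and at most two edges
-- to neighbours of its own colour.
--
-- Start from the set H of monochromatic edges, which has maximum degree 2.  The
-- other edges are classified by the colour and port of the tail and the port of
-- the head.  Each class is a matching, so in one round per class H can be
-- extended greedily while keeping its degrees at most 2.  Finally every edge
-- outside H has an endpoint with two edges in H, so the value 1 on isolated
-- edges of H, ½ on its other edges and 0 outside H is as wanted.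
module Submission where

open import Defs
open import Data.Bool using (Bool; true; false; not; _∧_; _∨_; if_then_else_; T)
open import Data.Bool.Properties using (T?; T-irrelevant; ∨-comm; ¬-not)
  renaming (_≟_ to _≟ᵇ_)
open import Data.Empty using (⊥-elim)
open import Data.Fin using (Fin; zero; suc; toℕ)
open import Data.Fin.Properties using (any?; toℕ<n; toℕ-injective; suc-injective)
  renaming (_≟_ to _≟ᶠ_)
open import Data.List using (List; []; _∷_; length; upTo; cartesianProduct)
open import Data.List.Membership.Propositional using (_∈_)
open import Data.List.Membership.Propositional.Properties using (∈-cartesianProduct⁺; ∈-upTo⁺)
open import Data.List.Relation.Unary.Any using (here; there)
open import Data.Maybe using (Maybe; just; nothing)
open import Data.Nat using (ℕ; zero; suc; _+_; _≤_; _<_; z≤n; s≤s; s≤s⁻¹; _≤ᵇ_; _<ᵇ_)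
open import Data.Nat.Properties using (≤-trans; ≤-antisym; +-suc; m≤n⇒m≤1+n; m≤n+m;
  ≤ᵇ⇒≤; ≤⇒≤ᵇ; ≰⇒>; +-cancelˡ-≤; +-monoˡ-≤; module ≤-Reasoning) renaming (_≟_ to _≟ⁿ_)
open import Data.Product using (Σ-syntax; ∃; ∃-syntax; _×_; _,_; proj₁; proj₂)
open import Data.Product.Properties using (≡-dec)
open import Data.Rational using (ℚ; 0ℚ; 1ℚ; ½)
open import Data.Rational.Properties using (+-identityˡ; +-identityʳ; +-0-commutativeMonoid)
open import Data.Sum using (_⊎_; inj₁; inj₂)
import Data.Sum as Sum
open import Data.Unit using (tt)
open import Function using (_∘_; module Inverse)
open import Relation.Binary.Definitions using (DecidableEquality)
open import Relation.Binary.PropositionalEquality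
open import Relation.Nullary using (¬_; Dec; yes; no; does)
open import Relation.Nullary.Decidable using (from-yes; dec-true)

import Data.Rational as ℚ
import Data.Rational.Properties as ℚ
import Algebra.Properties.CommutativeMonoid.Sum +-0-commutativeMonoid as ℚSum

-- Counting the true values of a Boolean function

bit : Bool → ℕ
bit b = if b then 1 else 0

count : ∀ {d} → (Fin d → Bool) → ℕ
count {zero}  f = 0
count {suc d} f = bit (f zero) + count (f ∘ suc)

count-mono : ∀ {d} {f g : Fin d → Bool} →
             (∀ i → f i ≡ true → g i ≡ true) → count f ≤ count g
count-mono {zero} f⊆g = z≤n
count-mono {suc d} {f} {g} f⊆g
  with f zero in f₀ | g zero in g₀ | count-mono (f⊆g ∘ suc)
... | true  | true  | rest = s≤s rest
... | false | b     | rest = ≤-trans rest (m≤n+m _ (bit b))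
... | true  | false | rest with () ← trans (sym g₀) (f⊆g zero f₀)

count-complement : ∀ {d} (f : Fin d → Bool) → count f + count (not ∘ f) ≡ d
count-complement {zero} f = refl
count-complement {suc d} f with f zero | count-complement (f ∘ suc)
... | true  | rest = cong suc rest
... | false | rest = trans (+-suc _ _) (cong suc rest)

count≥1 : ∀ {d} {f : Fin d → Bool} i → f i ≡ true → 1 ≤ count f
count≥1 zero fi rewrite fi = s≤s z≤n
count≥1 {f = f} (suc i) fi = ≤-trans (count≥1 i fi) (m≤n+m _ (bit (f zero)))

count≤1⇒unique : ∀ {d} {f : Fin d → Bool} → count f ≤ 1 →
                 ∀ {i j} → f i ≡ true → f j ≡ true → i ≡ j
count≤1⇒unique c {zero} {zero} fi fj = refl
count≤1⇒unique c {zero} {suc j} fi fj rewrite fi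
  with s≤s () ← ≤-trans (s≤s (count≥1 j fj)) c
count≤1⇒unique c {suc i} {zero} fi fj rewrite fj
  with s≤s () ← ≤-trans (s≤s (count≥1 i fi)) c
count≤1⇒unique {f = f} c {suc i} {suc j} fi fj =
  cong suc (count≤1⇒unique (≤-trans (m≤n+m _ (bit (f zero))) c) fi fj)

-- Serves to bound degrees: a set of ports gaining at most one new element grows by at most one.
count-insert : ∀ {d} {f g : Fin d → Bool} →
               (∀ {i j} → f i ≡ false → g i ≡ true →
                          f j ≡ false → g j ≡ true → i ≡ j) →
               count g ≤ suc (count f)
count-insert {zero} unique = z≤n
count-insert {suc d} {f} {g} unique with f zero in f₀ | g zero in g₀
... | true  | true  = s≤s (count-insert λ p q r s → suc-injective (unique p q r s))
... | false | false = count-insert λ p q r s → suc-injective (unique p q r s)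
... | true  | false =
  m≤n⇒m≤1+n (count-insert λ p q r s → suc-injective (unique p q r s))
-- Index `zero` is already the one new element, so the rest of `g` lies inside `f`.
... | false | true  = s≤s (count-mono old)
  where
  old : ∀ i → g (suc i) ≡ true → f (suc i) ≡ true
  old i gi with f (suc i) in fi
  ... | true  = refl
  ... | false with () ← unique f₀ g₀ fi gi

-- One threshold with two uses. On the outgoing ports of a node of degree at most 3 it picks a
-- direction from which at most one edge deviates; on selected edges it marks a node that can take
-- no more.
full : ∀ {d} → (Fin d → Bool) → Bool
full f = 2 ≤ᵇ count f

full⇒count≥2 : ∀ {d} (f : Fin d → Bool) → full f ≡ true → 2 ≤ count f
full⇒count≥2 f eq = ≤ᵇ⇒≤ _ _ (subst T (sym eq) tt)

¬full⇒count≤1 : ∀ {d} (f : Fin d → Bool) → full f ≡ false → count f ≤ 1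
¬full⇒count≤1 f eq = s≤s⁻¹ (≰⇒> λ c → subst T eq (≤⇒≤ᵇ c))

full-mono : ∀ {d} {f g : Fin d → Bool} →
            (∀ i → f i ≡ true → g i ≡ true) → full f ≡ true → full g ≡ true
full-mono {f = f} {g} f⊆g eq with full g in eq′
... | true  = refl
... | false with s≤s () ← ≤-trans (full⇒count≥2 f eq)
                            (≤-trans (count-mono f⊆g) (¬full⇒count≤1 g eq′))

-- Finite sums of rationals

sum-zero : ∀ {d} {g : Fin d → ℚ} → (∀ i → g i ≡ 0ℚ) → ℚSum.sum g ≡ 0ℚ
sum-zero {d} z = trans (ℚSum.sum-cong-≗ z) (ℚSum.sum-replicate-zero d)

sum-single : ∀ {d} {g : Fin d → ℚ} k →
             (∀ i → i ≢ k → g i ≡ 0ℚ) → ℚSum.sum g ≡ g k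
sum-single {suc d} {g} zero z =
  trans (cong (g zero ℚ.+_) (sum-zero λ i → z (suc i) λ ())) (+-identityʳ _)
sum-single {suc d} {g} (suc k) z =
  trans (cong₂ ℚ._+_ (z zero λ ()) (sum-single k λ i i≢k → z (suc i) (i≢k ∘ suc-injective)))
        (+-identityˡ _)

-- Local rules of the algorithm

Colour : Set
Colour = Bool × ℕ

EdgeClass : Set
EdgeClass = Colour × ℕ × ℕ

_≟ᶜ_ : DecidableEquality Colour
_≟ᶜ_ = ≡-dec _≟ᵇ_ _≟ⁿ_

_≟ᵉ_ : DecidableEquality EdgeClass
_≟ᵉ_ = ≡-dec _≟ᶜ_ (≡-dec _≟ⁿ_ _≟ⁿ_)

-- Two directions and three port numbers in each of three places give 54 classes, whatever the
-- graph; this constant governs the running time.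
edgeClasses : List EdgeClass
edgeClasses = cartesianProduct (cartesianProduct (true ∷ false ∷ []) (upTo 3))
                               (cartesianProduct (upTo 3) (upTo 3))

-- The default 0 covers a node where every edge follows the majority; being below 3, it keeps the
-- colour inside the palette of `edgeClasses`.
valueAtWitness : ∀ {d} {P : Fin d → Set} → (Fin d → ℕ) → Dec (∃ P) → ℕ
valueAtWitness q (yes (i , _)) = q i
valueAtWitness q (no _)        = 0

-- full outgoing is the majority orientation, and far i is the port number at
-- the other end of the edge at port i.
colour : ∀ {d} (outgoing : Fin d → Bool) (far : Fin d → ℕ) → Colour
colour outgoing far =
  full outgoing , valueAtWitness far (any? λ i → outgoing i ≟ᵇ not (full outgoing))

-- Both endpoints compute the same triple: colour of the tail, port at the tail, port at the head.
edgeClass : (outgoing : Bool) (own other : Colour) (near far : ℕ) → EdgeClass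
edgeClass outgoing own other near far =
  if outgoing then (own , near , far) else (other , far , near)

augment : (current class : EdgeClass) (selected ownFull otherFull : Bool) → Bool
augment κ e h f f′ = h ∨ (does (e ≟ᵉ κ) ∧ not (f ∨ f′))

-- A selected edge with no full end is the only selected edge at both its ends, hence isolated.
edgeValue : (selected ownFull otherFull : Bool) → ℚ
edgeValue h f f′ = if h then (if f ∨ f′ then ½ else 1ℚ) else 0ℚ

edgeClass-swap : ∀ o {c c′ i j} → edgeClass (not o) c′ c j i ≡ edgeClass o c c′ i j
edgeClass-swap true  = refl
edgeClass-swap false = refl

augment-comm : ∀ κ e h f f′ → augment κ e h f f′ ≡ augment κ e h f′ f
augment-comm κ e h f f′ = cong (λ b → h ∨ (does (e ≟ᵉ κ) ∧ not b)) (∨-comm f f′)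

edgeValue-comm : ∀ h f f′ → edgeValue h f f′ ≡ edgeValue h f′ f
edgeValue-comm h f f′ = cong (λ b → if h then (if b then ½ else 1ℚ) else 0ℚ) (∨-comm f f′)

-- If at least two of at most three edges go out, at most one comes in; otherwise at most one goes
-- out.
minority-unique : ∀ {d} {o : Fin d → Bool} → d ≤ 3 → ∀ {i j} →
                  o i ≡ not (full o) → o j ≡ not (full o) → i ≡ j
minority-unique {d} {o} d≤3 p q with full o in eq
... | false = count≤1⇒unique (¬full⇒count≤1 o eq) p q
... | true  = count≤1⇒unique {f = not ∘ o} (+-cancelˡ-≤ 2 _ _ (begin
      2 + count (not ∘ o)       ≤⟨ +-monoˡ-≤ _ (full⇒count≥2 o eq) ⟩
      count o + count (not ∘ o) ≡⟨ count-complement o ⟩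
      d                         ≤⟨ d≤3 ⟩
      3                         ∎)) (cong not p) (cong not q)
  where open ≤-Reasoning

colour-minority : ∀ {d} {o : Fin d → Bool} {q : Fin d → ℕ} → d ≤ 3 → ∀ {k} →
                  o k ≡ not (full o) → proj₂ (colour o q) ≡ q k
colour-minority {o = o} {q} d≤3 {k} ok with any? (λ i → o i ≟ᵇ not (full o))
... | yes (i , oi) = cong q (minority-unique {o = o} d≤3 oi ok)
... | no ∄         = ⊥-elim (∄ (k , ok))

colour-bound : ∀ {d} (o : Fin d → Bool) {q : Fin d → ℕ} →
               (∀ i → q i < 3) → proj₂ (colour o q) < 3
colour-bound o q<3 with any? (λ i → o i ≟ᵇ not (full o))
... | yes (i , _) = q<3 i
... | no _        = s≤s z≤n

∈-bools : ∀ b → b ∈ true ∷ false ∷ []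
∈-bools true  = here refl
∈-bools false = there (here refl)

∈-edgeClasses : ∀ {e : EdgeClass} → let ((_ , r) , i , j) = e in
                r < 3 → i < 3 → j < 3 → e ∈ edgeClasses
∈-edgeClasses r<3 i<3 j<3 =
  ∈-cartesianProduct⁺ (∈-cartesianProduct⁺ (∈-bools _) (∈-upTo⁺ r<3))
                      (∈-cartesianProduct⁺ (∈-upTo⁺ i<3) (∈-upTo⁺ j<3))

augment-selected : ∀ κ e {h} f f′ → h ≡ true → augment κ e h f f′ ≡ true
augment-selected _ _ _ _ refl = refl

augment-new : ∀ κ e {h} f f′ → h ≡ false → augment κ e h f f′ ≡ true →
              e ≡ κ × f ≡ false
augment-new κ e false f′ refl a with e ≟ᵉ κ
... | yes e≡κ = e≡κ , refl
augment-new κ e true f′ refl a with e ≟ᵉ κ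
... | yes _ with () ← a
... | no _  with () ← a

-- The source of maximality: in the round of its own class, an edge is refused only because of a
-- full end.
augment-rejected : ∀ κ e h f f′ → augment κ e h f f′ ≡ false →
                   h ≡ false × (e ≡ κ → f ≡ true ⊎ f′ ≡ true)
augment-rejected κ e false f f′ a = refl , λ e≡κ → blocked e≡κ f f′ a
  where
  blocked : e ≡ κ → ∀ f f′ → augment κ e false f f′ ≡ false → f ≡ true ⊎ f′ ≡ true
  blocked e≡κ true  _     a = inj₁ refl
  blocked e≡κ false true  a = inj₂ refl
  blocked e≡κ false false a rewrite dec-true (e ≟ᵉ κ) e≡κ with () ← a

-- Load at a single node

halves : ℕ → ℚ
halves zero    = 0ℚ
halves (suc k) = ½ ℚ.+ halves k

sum-halves : ∀ {d} (h : Fin d → Bool) →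
             ℚSum.sum (λ i → if h i then ½ else 0ℚ) ≡ halves (count h)
sum-halves {zero}  h = refl
sum-halves {suc d} h with h zero
... | true  = cong (½ ℚ.+_) (sum-halves (h ∘ suc))
... | false = trans (+-identityˡ _) (sum-halves (h ∘ suc))

module _ {d} (h s : Fin d → Bool) where

  localLoad : ℚ
  localLoad = ℚSum.sum (λ i → edgeValue (h i) (full h) (s i))

  localLoad-full : count h ≤ 2 → full h ≡ true → localLoad ≡ 1ℚ
  -- At a full node every selected edge carries ½. There are exactly two of them, and `halves 2`
  -- evaluates to `1ℚ`.
  localLoad-full c≤2 eq rewrite eq =
    trans (sum-halves h) (cong halves (≤-antisym c≤2 (full⇒count≥2 h eq)))

  localLoad-single : full h ≡ false → ∀ i → h i ≡ true →
                     localLoad ≡ edgeValue true (full h) (s i)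
  localLoad-single eq i hi =
    trans (sum-single i others) (cong (λ b → edgeValue b (full h) (s i)) hi)
    where
    others : ∀ j → j ≢ i → edgeValue (h j) (full h) (s j) ≡ 0ℚ
    others j j≢i with h j in hj
    ... | false = refl
    ... | true  = ⊥-elim (j≢i (count≤1⇒unique (¬full⇒count≤1 h eq) hj hi))

edgeValue-halfIntegral : ∀ h f f′ →
  edgeValue h f f′ ≡ 0ℚ ⊎ edgeValue h f f′ ≡ ½ ⊎ edgeValue h f f′ ≡ 1ℚ
edgeValue-halfIntegral false f f′ = inj₁ refl
edgeValue-halfIntegral true f f′ with f ∨ f′
... | true  = inj₂ (inj₁ refl)
... | false = inj₂ (inj₂ refl)

0≤halfIntegral≤1 : ∀ {y} → y ≡ 0ℚ ⊎ y ≡ ½ ⊎ y ≡ 1ℚ → 0ℚ ℚ.≤ y × y ℚ.≤ 1ℚ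
0≤halfIntegral≤1 (inj₁ refl)        = from-yes (0ℚ ℚ.≤? 0ℚ) , from-yes (0ℚ ℚ.≤? 1ℚ)
0≤halfIntegral≤1 (inj₂ (inj₁ refl)) = from-yes (0ℚ ℚ.≤? ½) , from-yes (½ ℚ.≤? 1ℚ)
0≤halfIntegral≤1 (inj₂ (inj₂ refl)) = from-yes (0ℚ ℚ.≤? 1ℚ) , from-yes (1ℚ ℚ.≤? 1ℚ)

localLoad≤1 : ∀ {d} (h s : Fin d → Bool) → count h ≤ 2 → localLoad h s ℚ.≤ 1ℚ
localLoad≤1 h s c≤2 = decide (full h) refl
  where
  decide : ∀ b → full h ≡ b → localLoad h s ℚ.≤ 1ℚ
  decide true  eq = ℚ.≤-reflexive (localLoad-full h s c≤2 eq)
  decide false eq with any? (λ i → h i ≟ᵇ true)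
  ... | yes (i , hi) = ℚ.≤-trans (ℚ.≤-reflexive (localLoad-single h s eq i hi))
          (proj₂ (0≤halfIntegral≤1 (edgeValue-halfIntegral true (full h) (s i))))
  ... | no ∄ = ℚ.≤-trans
          (ℚ.≤-reflexive (sum-zero λ i →
            cong (λ b → edgeValue b (full h) (s i)) (¬-not (∄ ∘ (i ,_)))))
          (from-yes (0ℚ ℚ.≤? 1ℚ))

-- The algorithm as a state machine

data State (d : ℕ) : Set where
  start      : (identifier : ℕ) → State d
  oriented   : (outgoing : Fin d → Bool) (far : Fin d → ℕ) → State d
  augmenting : (pending : List EdgeClass) (class : Fin d → EdgeClass)
               (selected : Fin d → Bool) → State d
  done       : (Fin d → ℚ) → State d

-- A node sends its whole state and the number of the port it sends it through.
Message : Set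
Message = (∃[ d ] State d) × ℕ

-- All nodes pass through the phases in lockstep, so a message is always read in the phase of its
-- sender; the catch-all clauses of this and the next two functions serve totality.
identifierOf : Message → ℕ
identifierOf ((_ , start k) , _) = k
identifierOf _                   = 0

colourOf : Message → Colour
colourOf ((_ , oriented o q) , _) = colour o q
colourOf _                        = true , 0

fullOf : Message → Bool
fullOf ((_ , augmenting _ _ h) , _) = full h
fullOf _                            = true

matchingAlgorithm : Algorithm ℚ
matchingAlgorithm = record
  { State   = State
  ; Message = Message
  ; init    = λ _ → start
  ; send    = λ s i → (_ , s) , toℕ i
  ; receive = receive
  ; output  = output
  }
  where
  receive : ∀ {d} → State d → (Fin d → Message) → State d
  -- The number attached to each message is the far port of the edge.
  receive (start k) m = oriented (λ i → k <ᵇ identifierOf (m i)) (proj₂ ∘ m)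
  receive (oriented o q) m = augmenting edgeClasses
    (λ i → edgeClass (o i) (colour o q) (colourOf (m i)) (toℕ i) (q i))
    (λ i → does (colour o q ≟ᶜ colourOf (m i)))
  receive (augmenting (κ ∷ κs) e h) m = augmenting κs e
    (λ i → augment κ (e i) (h i) (full h) (fullOf (m i)))
  -- One further round is spent here, since a neighbour's final fullness is known only from its next
  -- message.
  receive (augmenting [] e h) m = done
    (λ i → edgeValue (h i) (full h) (fullOf (m i)))
  receive (done x) m = done x

  output : ∀ {d} → State d → Maybe (Fin d → ℚ)
  output (done x) = just x
  output _        = nothing

<ᵇ-flip : ∀ {m n} → m ≢ n → (n <ᵇ m) ≡ not (m <ᵇ n)
<ᵇ-flip {zero}  {zero}  m≢n = ⊥-elim (m≢n refl)
<ᵇ-flip {zero}  {suc n} m≢n = refl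
<ᵇ-flip {suc m} {zero}  m≢n = refl
<ᵇ-flip {suc m} {suc n} m≢n = <ᵇ-flip {m} {n} (m≢n ∘ cong suc)

does-true : ∀ {A : Set} (a? : Dec A) → does a? ≡ true → A
does-true (yes a) _ = a

does-false : ∀ {A : Set} (a? : Dec A) → does a? ≡ false → ¬ A
does-false (no ¬a) _ = ¬a

-- Darts: edges seen from one endpoint

module Darts {n} (G : Graph n) (p : PortNumbering G) where
  open Graph G

  Dart : Set
  Dart = Σ[ v ∈ Fin n ] Fin (degree v)

  source : Dart → Fin n
  source = proj₁

  port : Dart → ℕ
  port (_ , i) = toℕ i

  dart : ∀ v → (∃[ u ] v ~ u) → Dart
  dart v e = v , Inverse.from (p v) e

  -- Unfolds to the `neighbour` and `oppositePort` of the execution, so messages can be described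
  -- through darts by computation alone.
  flip : Dart → Dart
  flip (v , i) =
    let (u , e) = Inverse.to (p v) i in dart u (v , ~-sym e)

  target : Dart → Fin n
  target = source ∘ flip

  dart-edge : ∀ v i → dart v (Inverse.to (p v) i) ≡ (v , i)
  dart-edge v i = cong (v ,_) (Inverse.strictlyInverseʳ (p v) i)

  flip-dart : ∀ {u v} (e : u ~ v) → flip (dart u (v , e)) ≡ dart v (u , ~-sym e)
  flip-dart {u} {v} e =
    cong (λ (w , e′) → dart w (u , ~-sym e′)) (Inverse.strictlyInverseˡ (p u) (v , e))

  flip-flip : ∀ d → flip (flip d) ≡ d
  flip-flip (v , i) = let (u , e) = Inverse.to (p v) i in begin
    flip (dart u (v , ~-sym e))    ≡⟨ flip-dart (~-sym e) ⟩
    dart v (u , ~-sym (~-sym e))   ≡⟨ cong (λ e′ → dart v (u , e′)) (T-irrelevant _ e) ⟩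
    dart v (u , e)                 ≡⟨ dart-edge v i ⟩
    (v , i)                        ∎
    where open ≡-Reasoning

  target-dart : ∀ {u v} (e : u ~ v) → target (dart u (v , e)) ≡ v
  target-dart e = cong source (flip-dart e)

  source≢target : ∀ d → source d ≢ target d
  source≢target (v , i) eq =
    ~-irrefl (subst (v ~_) (sym eq) (proj₂ (Inverse.to (p v) i)))

  edgeFunction : (w : Dart → ℚ) → (∀ d → w (flip d) ≡ w d) → EdgeFunction G
  edgeFunction w w-flip = record
    { value     = λ {u} {v} e → w (dart u (v , e))
    ; value-sym = λ e → trans (cong w (sym (flip-dart e))) (w-flip _)
    }

  -- Double counting in the matrix `entry` of ports against nodes. The row of a port contributes
  -- only at the node it leads to; the column of a node contributes only at the port leading there,
  -- or vanishes if there is none.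
  load-ports : (x : EdgeFunction G) → ∀ v →
    load x v ≡ ℚSum.sum (λ i → EdgeFunction.value x (proj₂ (Inverse.to (p v) i)))
  load-ports x v = begin
    ℚSum.sum y
      ≡⟨ ℚSum.sum-cong-≗ (λ u → sym (column u (T? (adjacent v u)))) ⟩
    ℚSum.sum (λ u → ℚSum.sum (λ i → entry i u))
      ≡⟨ ℚSum.∑-comm (λ u i → entry i u) ⟩
    ℚSum.sum (λ i → ℚSum.sum (entry i))
      ≡⟨ ℚSum.sum-cong-≗ row ⟩
    ℚSum.sum (λ i → value (proj₂ (to i))) ∎
    where
    open ≡-Reasoning
    open EdgeFunction x
    open Inverse (p v) using (to; from; strictlyInverseˡ; strictlyInverseʳ)

    y : Fin n → ℚ
    y u = valueOr0 x (T? (adjacent v u))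

    entry : Fin (degree v) → Fin n → ℚ
    entry i u = if does (proj₁ (to i) ≟ᶠ u) then y u else 0ℚ

    y-yes : ∀ {u} (e : v ~ u) (e? : Dec (v ~ u)) → valueOr0 x e? ≡ value e
    y-yes e (yes e′) = cong value (T-irrelevant e′ e)
    y-yes e (no ¬e)  = ⊥-elim (¬e e)

    entry-off : ∀ {i u} → proj₁ (to i) ≢ u → entry i u ≡ 0ℚ
    entry-off {i} {u} ≢u with proj₁ (to i) ≟ᶠ u
    ... | yes ≡u = ⊥-elim (≢u ≡u)
    ... | no _   = refl

    entry-on : ∀ {i u} → proj₁ (to i) ≡ u → entry i u ≡ y u
    entry-on {i} {u} ≡u rewrite dec-true (proj₁ (to i) ≟ᶠ u) ≡u = refl

    row : ∀ i → ℚSum.sum (entry i) ≡ value (proj₂ (to i))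
    row i = begin
      ℚSum.sum (entry i)       ≡⟨ sum-single _ (λ u u≢ → entry-off (u≢ ∘ sym)) ⟩
      entry i (proj₁ (to i))   ≡⟨ entry-on refl ⟩
      y (proj₁ (to i))         ≡⟨ y-yes (proj₂ (to i)) (T? _) ⟩
      value (proj₂ (to i))     ∎

    column : ∀ u → Dec (v ~ u) → ℚSum.sum (λ i → entry i u) ≡ y u
    column u (yes e) = begin
      ℚSum.sum (λ i → entry i u) ≡⟨ sum-single k others ⟩
      entry k u                  ≡⟨ entry-on (cong proj₁ (strictlyInverseˡ (u , e))) ⟩
      y u                        ∎
      where
      k : Fin (degree v)
      k = from (u , e)

      from-unique : ∀ i → proj₁ (to i) ≡ u → i ≡ k
      from-unique i refl =
        trans (sym (strictlyInverseʳ i)) (cong (λ e′ → from (u , e′)) (T-irrelevant _ e))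

      others : ∀ i → i ≢ k → entry i u ≡ 0ℚ
      others i i≢k = entry-off {i} {u} (i≢k ∘ from-unique i)
    column u (no ¬e) = trans (sum-zero zeros) (sym (y-no (T? (adjacent v u))))
      where
      y-no : ∀ (e? : Dec (v ~ u)) → valueOr0 x e? ≡ 0ℚ
      y-no (yes e) = ⊥-elim (¬e e)
      y-no (no _)  = refl

      zeros : ∀ i → entry i u ≡ 0ℚ
      zeros i = entry-off {i} {u} λ ≡u → ¬e (subst (v ~_) ≡u (proj₂ (to i)))

-- Correctness: colours and monochromatic edges

module Correctness {n} (G : Graph n) (Δ≤3 : MaxDegree≤ 3 G)
                   (p : PortNumbering G) {c} (ids : Identifiers c n) where
  open Graph G
  open Identifiers ids
  open Darts G p
  open Execution matchingAlgorithm G p ids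

  port<3 : ∀ d → port d < 3
  port<3 (v , i) = ≤-trans (toℕ<n i) (Δ≤3 v)

  outgoing : Dart → Bool
  outgoing d = id (source d) <ᵇ id (target d)

  colourAt : Fin n → Colour
  colourAt v = colour (λ i → outgoing (v , i)) (λ i → port (flip (v , i)))

  classOf : Dart → EdgeClass
  classOf d = edgeClass (outgoing d) (colourAt (source d)) (colourAt (target d))
                        (port d) (port (flip d))

  monochromatic : Dart → Bool
  monochromatic d = does (colourAt (source d) ≟ᶜ colourAt (target d))

  -- Adjacent nodes have distinct identifiers, so exactly one end sees the edge as outgoing.
  outgoing-flip : ∀ d → outgoing (flip d) ≡ not (outgoing d)
  outgoing-flip d = trans
    (cong (λ d′ → id (target d) <ᵇ id (source d′)) (flip-flip d))
    (<ᵇ-flip (source≢target d ∘ injective))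

  -- The edge deviates from the common majority at its target, so the target's colour records the
  -- port at the other end, which is `port d`; equality of colours carries this back to the source.
  port-agreeing : ∀ d → colourAt (source d) ≡ colourAt (target d) →
                  outgoing d ≡ proj₁ (colourAt (source d)) →
                  port d ≡ proj₂ (colourAt (source d))
  port-agreeing d same agrees = sym (begin
    proj₂ (colourAt (source d)) ≡⟨ cong proj₂ same ⟩
    proj₂ (colourAt (target d)) ≡⟨ colour-minority {o = λ i → outgoing (target d , i)}
                                     (Δ≤3 (target d)) disagrees ⟩
    port (flip (flip d))        ≡⟨ cong port (flip-flip d) ⟩
    port d                      ∎)
    where
    open ≡-Reasoning
    disagrees : outgoing (flip d) ≡ not (proj₁ (colourAt (target d)))
    disagrees = trans (outgoing-flip d) (cong not (trans agrees (cong proj₁ same)))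

  -- If both edges follow the majority, both ports equal the second component of the colour at `v`;
  -- if both deviate, the minority edge is unique.
  monochromatic-unique : ∀ {v i j} →
    monochromatic (v , i) ≡ true → monochromatic (v , j) ≡ true →
    outgoing (v , i) ≡ outgoing (v , j) → i ≡ j
  monochromatic-unique {v} {i} {j} mi mj oi≡oj
    with outgoing (v , i) ≟ᵇ proj₁ (colourAt v)
  ... | yes oi = toℕ-injective (trans
          (port-agreeing (v , i) (does-true (_ ≟ᶜ _) mi) oi)
          (sym (port-agreeing (v , j) (does-true (_ ≟ᶜ _) mj) (trans (sym oi≡oj) oi))))
  ... | no oi  = minority-unique {o = λ i → outgoing (v , i)} (Δ≤3 v)
          (¬-not oi) (trans (sym oi≡oj) (¬-not oi))

  count-monochromatic : ∀ v → count (λ i → monochromatic (v , i)) ≤ 2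
  count-monochromatic v =
    -- From the empty set to the outgoing monochromatic edges, then to all of them: each step adds
    -- at most one edge.
    ≤-trans (count-insert incoming) (s≤s (≤-trans (count-insert out) (s≤s none)))
    where
    mono out-mono : Fin (degree v) → Bool
    mono i     = monochromatic (v , i)
    out-mono i = outgoing (v , i) ∧ mono i

    none : count {degree v} (λ _ → false) ≤ 0
    none = zeros (degree v)
      where
      zeros : ∀ d → count {d} (λ _ → false) ≤ 0
      zeros zero    = z≤n
      zeros (suc d) = zeros d

    ∧-true : ∀ {a b} → a ∧ b ≡ true → a ≡ true × b ≡ true
    ∧-true {true} eq = refl , eq

    out : ∀ {i j} → false ≡ false → out-mono i ≡ true →
          false ≡ false → out-mono j ≡ true → i ≡ j
    out _ p _ q =
      let (oi , mi) = ∧-true p ; (oj , mj) = ∧-true q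
      in monochromatic-unique mi mj (trans oi (sym oj))

    ∧-false : ∀ {a b} → a ∧ b ≡ false → b ≡ true → a ≡ false
    ∧-false {false} _ _ = refl
    ∧-false {true} refl ()

    incoming : ∀ {i j} → out-mono i ≡ false → mono i ≡ true →
               out-mono j ≡ false → mono j ≡ true → i ≡ j
    incoming p mi q mj =
      monochromatic-unique mi mj (trans (∧-false p mi) (sym (∧-false q mj)))

  -- Edge classes as matchings

  classOf-flip : ∀ d → classOf (flip d) ≡ classOf d
  classOf-flip d = begin
    classOf (flip d)
      ≡⟨ cong (λ d′ → edgeClass (outgoing (flip d)) (colourAt (target d))
                        (colourAt (source d′)) (port (flip d)) (port d′)) (flip-flip d) ⟩
    edgeClass (outgoing (flip d)) (colourAt (target d)) (colourAt (source d))
              (port (flip d)) (port d)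
      ≡⟨ cong (λ o → edgeClass o (colourAt (target d)) (colourAt (source d))
                       (port (flip d)) (port d)) (outgoing-flip d) ⟩
    edgeClass (not (outgoing d)) (colourAt (target d)) (colourAt (source d))
              (port (flip d)) (port d)
      ≡⟨ edgeClass-swap (outgoing d) ⟩
    classOf d ∎
    where open ≡-Reasoning

  Bichromatic : Dart → Set
  Bichromatic d = colourAt (source d) ≢ colourAt (target d)

  -- Two outgoing edges of one class share the tail port, two incoming ones the head port. With one
  -- of each, the tail of the incoming edge would have the colour of `v`, which bichromaticity
  -- forbids.
  classOf-unique : ∀ {v i j} → Bichromatic (v , i) → Bichromatic (v , j) →
                   classOf (v , i) ≡ classOf (v , j) → i ≡ j
  classOf-unique {v} {i} {j} bi bj eq with outgoing (v , i) | outgoing (v , j)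
  ... | true  | true  = toℕ-injective (cong (proj₁ ∘ proj₂) eq)
  ... | false | false = toℕ-injective (cong (proj₂ ∘ proj₂) eq)
  ... | true  | false = ⊥-elim (bj (cong proj₁ eq))
  ... | false | true  = ⊥-elim (bi (sym (cong proj₁ eq)))

  -- The greedy extension and its invariant

  fullAt : (Dart → Bool) → Fin n → Bool
  fullAt H v = full (λ i → H (v , i))

  -- `κs` holds the classes still to be processed, so once it is empty every unselected edge has a
  -- full end. Bichromaticity of the unselected edges makes the candidates of each class a matching.
  record Invariant (κs : List EdgeClass) (H : Dart → Bool) : Set where
    field
      symmetric   : ∀ d → H (flip d) ≡ H d
      degree≤2    : ∀ v → count (λ i → H (v , i)) ≤ 2
      bichromatic : ∀ d → H d ≡ false → Bichromatic d
      blocked     : ∀ d → H d ≡ false → classOf d ∈ κs ⊎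
                    (fullAt H (source d) ≡ true ⊎ fullAt H (target d) ≡ true)

  invariant-start : Invariant edgeClasses monochromatic
  invariant-start = record
    { symmetric   = λ d → trans
        (cong (λ d′ → does (colourAt (target d) ≟ᶜ colourAt (source d′))) (flip-flip d))
        (≟ᶜ-sym (colourAt (target d)) (colourAt (source d)))
    ; degree≤2    = count-monochromatic
    ; bichromatic = λ d → does-false (_ ≟ᶜ _)
    ; blocked     = λ d _ → inj₁ (classOf∈ d)
    }
    where
    ≟ᶜ-sym : ∀ a b → does (a ≟ᶜ b) ≡ does (b ≟ᶜ a)
    ≟ᶜ-sym a b with does (a ≟ᶜ b) in p | does (b ≟ᶜ a) in q
    ... | true  | true  = refl
    ... | false | false = refl
    ... | true  | false = ⊥-elim (does-false (b ≟ᶜ a) q (sym (does-true (a ≟ᶜ b) p)))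
    ... | false | true  = ⊥-elim (does-false (a ≟ᶜ b) p (sym (does-true (b ≟ᶜ a) q)))

    colour<3 : ∀ v → proj₂ (colourAt v) < 3
    colour<3 v = colour-bound (λ i → outgoing (v , i)) (λ i → port<3 (flip (v , i)))

    classOf∈ : ∀ d → classOf d ∈ edgeClasses
    classOf∈ d with outgoing d
    ... | true  = ∈-edgeClasses (colour<3 (source d)) (port<3 d) (port<3 (flip d))
    ... | false = ∈-edgeClasses (colour<3 (target d)) (port<3 (flip d)) (port<3 d)

  -- A full node gains no edge, and any other node gains at most one because the candidates form a
  -- matching. Edges are never deselected, so a full end that blocks an edge stays full.
  invariant-step : ∀ {κ κs} {H H′ : Dart → Bool} → Invariant (κ ∷ κs) H →
    (∀ d → H′ d ≡ augment κ (classOf d) (H d) (fullAt H (source d)) (fullAt H (target d))) →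
    Invariant κs H′
  invariant-step {κ} {κs} {H} {H′} inv H′-eq = record
    { symmetric   = symmetric′
    ; degree≤2    = degree′
    ; bichromatic = λ d → bichromatic d ∘ old d
    ; blocked     = blocked′
    }
    where
    open Invariant inv

    grow : ∀ d → H d ≡ true → H′ d ≡ true
    grow d h = trans (H′-eq d) (augment-selected κ (classOf d) (fullAt H (source d)) (fullAt H (target d)) h)

    old : ∀ d → H′ d ≡ false → H d ≡ false
    old d h = proj₁ (augment-rejected κ (classOf d) _ (fullAt H (source d)) (fullAt H (target d)) 
                      (trans (sym (H′-eq d)) h))

    new : ∀ {d} → H d ≡ false → H′ d ≡ true →
          classOf d ≡ κ × fullAt H (source d) ≡ false
    new {d} h h′ = augment-new κ (classOf d) (fullAt H (source d)) (fullAt H (target d)) h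
      (trans (sym (H′-eq d)) h′)

    grow-full : ∀ {v} → fullAt H v ≡ true → fullAt H′ v ≡ true
    grow-full {v} = full-mono {f = λ i → H (v , i)} (λ i → grow (v , i))

    symmetric′ : ∀ d → H′ (flip d) ≡ H′ d
    symmetric′ d = begin
      H′ (flip d)
        ≡⟨ H′-eq (flip d) ⟩
      augment κ (classOf (flip d)) (H (flip d)) (fullAt H (target d)) (fullAt H (target (flip d)))
        ≡⟨ cong₂ (λ e h → augment κ e h (fullAt H (target d)) (fullAt H (target (flip d))))
                 (classOf-flip d) (symmetric d) ⟩
      augment κ (classOf d) (H d) (fullAt H (target d)) (fullAt H (target (flip d)))
        ≡⟨ cong (λ d′ → augment κ (classOf d) (H d) (fullAt H (target d)) (fullAt H (source d′)))
                (flip-flip d) ⟩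
      augment κ (classOf d) (H d) (fullAt H (target d)) (fullAt H (source d))
        ≡⟨ augment-comm κ (classOf d) (H d) (fullAt H (target d)) (fullAt H (source d)) ⟩
      augment κ (classOf d) (H d) (fullAt H (source d)) (fullAt H (target d))
        ≡⟨ H′-eq d ⟨
      H′ d ∎
      where open ≡-Reasoning

    degree′ : ∀ v → count (λ i → H′ (v , i)) ≤ 2
    degree′ v = decide (fullAt H v) refl
      where
      decide : ∀ b → fullAt H v ≡ b → count (λ i → H′ (v , i)) ≤ 2
      decide true eq = ≤-trans (count-mono unchanged) (degree≤2 v)
        where
        unchanged : ∀ i → H′ (v , i) ≡ true → H (v , i) ≡ true
        unchanged i h′ with H (v , i) in h
        ... | true  = refl
        ... | false with () ← trans (sym eq) (proj₂ (new h h′))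
      decide false eq =
        ≤-trans (count-insert unique) (s≤s (¬full⇒count≤1 (λ i → H (v , i)) eq))
        where
        unique : ∀ {i j} → H (v , i) ≡ false → H′ (v , i) ≡ true →
                           H (v , j) ≡ false → H′ (v , j) ≡ true → i ≡ j
        unique hi hi′ hj hj′ = classOf-unique (bichromatic _ hi) (bichromatic _ hj)
          (trans (proj₁ (new hi hi′)) (sym (proj₁ (new hj hj′))))

    blocked′ : ∀ d → H′ d ≡ false → classOf d ∈ κs ⊎
               (fullAt H′ (source d) ≡ true ⊎ fullAt H′ (target d) ≡ true)
    blocked′ d h with blocked d (old d h)
    ... | inj₁ (there m) = inj₁ m
    ... | inj₂ f         = inj₂ (Sum.map grow-full grow-full f)
    ... | inj₁ (here e)  = inj₂ (Sum.map grow-full grow-full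
            (proj₂ (augment-rejected κ (classOf d) _ (fullAt H (source d)) (fullAt H (target d))
                      (trans (sym (H′-eq d)) h)) e))

  -- Tracing the execution

  Augmenting : ℕ → List EdgeClass → (Dart → Bool) → Set
  Augmenting t κs H =
    ∀ v → state t v ≡ augmenting κs (λ i → classOf (v , i)) (λ i → H (v , i))

  run : ∀ κs {t H} → Augmenting t κs H → Invariant κs H →
        ∃[ H′ ] (Augmenting (length κs + t) [] H′ × Invariant [] H′)
  run []       {t} {H} st inv = H , st , inv
  run (κ ∷ κs) {t} {H} st inv =
    let (H″ , st″ , inv″) = run κs {suc t} {H′} st′ inv′
    in H″ , subst (λ s → Augmenting s [] H″) (+-suc (length κs) t) st″ , inv″
    where
    message : ∀ d → Message
    message d = (_ , state t (target d)) , port (flip d)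

    -- Phrased through the received message, so that the next state follows by computation; `inv′`
    -- then replaces the message by the fullness of the target.
    H′ : Dart → Bool
    H′ d = augment κ (classOf d) (H d) (fullAt H (source d)) (fullOf (message d))

    st′ : Augmenting (suc t) κs H′
    st′ v = cong (λ s → Algorithm.step matchingAlgorithm s (λ i → message (v , i))) (st v)

    inv′ : Invariant κs H′
    inv′ = invariant-step inv λ d →
      cong (λ s → augment κ (classOf d) (H d) (fullAt H (source d))
                       (fullOf ((_ , s) , port (flip d))))
           (st (target d))

  -- The matching obtained from the final edge set

  module Solution {H : Dart → Bool} (inv : Invariant [] H) where
    open Invariant inv

    weight : Dart → ℚ
    weight d = edgeValue (H d) (fullAt H (source d)) (fullAt H (target d))

    weight-flip : ∀ d → weight (flip d) ≡ weight d
    weight-flip d = begin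
      edgeValue (H (flip d)) (fullAt H (target d)) (fullAt H (target (flip d)))
        ≡⟨ cong₂ (λ h d′ → edgeValue h (fullAt H (target d)) (fullAt H (source d′)))
                 (symmetric d) (flip-flip d) ⟩
      edgeValue (H d) (fullAt H (target d)) (fullAt H (source d))
        ≡⟨ edgeValue-comm (H d) (fullAt H (target d)) (fullAt H (source d)) ⟩
      weight d ∎
      where open ≡-Reasoning

    x : EdgeFunction G
    x = edgeFunction weight weight-flip

    selected neighbourFull : ∀ v → Fin (degree v) → Bool
    selected v i      = H (v , i)
    neighbourFull v i = fullAt H (target (v , i))

    load-local : ∀ v → load x v ≡ localLoad (selected v) (neighbourFull v)
    load-local v = trans (load-ports x v)
      (ℚSum.sum-cong-≗ λ i → cong weight (dart-edge v i))

    saturated-full : ∀ {v} → fullAt H v ≡ true → Saturated x v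
    saturated-full {v} eq = trans (load-local v)
      (localLoad-full (selected v) (neighbourFull v) (degree≤2 v) eq)

    saturated-isolated : ∀ d → H d ≡ true → fullAt H (source d) ≡ false →
                         fullAt H (target d) ≡ false → Saturated x (source d)
    saturated-isolated (v , i) h f f′ = trans (load-local v)
      (trans (localLoad-single (selected v) (neighbourFull v) f i h)
             (cong₂ (edgeValue true) f f′))

    -- A full end is saturated by two halves. If neither end is full, the edge must be selected, as
    -- no class is pending; it is then isolated and saturates its ends with value 1.
    maximal : ∀ d → Saturated x (source d) ⊎ Saturated x (target d)
    maximal d = decide (H d) refl (fullAt H (source d)) refl (fullAt H (target d)) refl
      where
      unblocked : fullAt H (source d) ≡ false → fullAt H (target d) ≡ false → H d ≢ false
      unblocked f f′ h with blocked d h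
      ... | inj₂ (inj₁ f₁) with () ← trans (sym f) f₁
      ... | inj₂ (inj₂ f₂) with () ← trans (sym f′) f₂

      decide : ∀ b → H d ≡ b → ∀ b₁ → fullAt H (source d) ≡ b₁ →
               ∀ b₂ → fullAt H (target d) ≡ b₂ →
               Saturated x (source d) ⊎ Saturated x (target d)
      decide _     _ true  f _     _  = inj₁ (saturated-full f)
      decide _     _ false _ true  f′ = inj₂ (saturated-full f′)
      decide true  h false f false f′ = inj₁ (saturated-isolated d h f f′)
      decide false h false f false f′ = ⊥-elim (unblocked f f′ h)

    isSolution : IsMaximalHalfIntegralMatching x
    isSolution = record
      { isMaximalFractionalMatching = record
        { isFractionalMatching = record
          { value≥0 = λ e → proj₁ (0≤halfIntegral≤1 (halfIntegral e))
          ; value≤1 = λ e → proj₂ (0≤halfIntegral≤1 (halfIntegral e))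
          ; load≤1  = λ v → ℚ.≤-trans (ℚ.≤-reflexive (load-local v))
                              (localLoad≤1 (selected v) (neighbourFull v) (degree≤2 v))
          }
        ; maximal = λ {u} {v} e → Sum.map₂ (subst (Saturated x) (target-dart e))
                                           (maximal (dart u (v , e)))
        }
      ; halfIntegral = halfIntegral
      }
      where
      open EdgeFunction x
      halfIntegral : ∀ {u v} (e : u ~ v) →
                     value e ≡ 0ℚ ⊎ value e ≡ ½ ⊎ value e ≡ 1ℚ
      halfIntegral {u} {v} e =
        let d = dart u (v , e)
        in edgeValue-halfIntegral (H d) (fullAt H (source d)) (fullAt H (target d))

    announces : ∀ {t} → Augmenting t [] H →
                AnnouncesWithin (suc t) matchingAlgorithm G p ids x
    announces {t} st v = o , cong output′ (st v) , λ i → trans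
      (cong (λ s → edgeValue (H (v , i)) (fullAt H v)
                     (fullOf ((_ , s) , port (flip (v , i))))) (st (target (v , i))))
      (sym (cong weight (dart-edge v i)))
      where
      message : Fin (degree v) → Message
      message i = (_ , state t (target (v , i))) , port (flip (v , i))

      o : Fin (degree v) → ℚ
      o i = edgeValue (H (v , i)) (fullAt H v) (fullOf (message i))

      output′ : State (degree v) → Maybe (Fin (degree v) → ℚ)
      output′ s = Algorithm.output matchingAlgorithm
        (Algorithm.step matchingAlgorithm s message)

  -- Total number of rounds

  finish : ∀ κs {t H} → Augmenting t κs H → Invariant κs H →
           Σ[ x ∈ EdgeFunction G ] (IsMaximalHalfIntegralMatching x ×
           AnnouncesWithin (suc (length κs + t)) matchingAlgorithm G p ids x)
  finish κs {t} st inv =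
    let (_ , st′ , inv′) = run κs st inv
    in Solution.x inv′ , Solution.isSolution inv′ ,
       Solution.announces inv′ {length κs + t} st′

  correct : Σ[ x ∈ EdgeFunction G ] (IsMaximalHalfIntegralMatching x ×
            AnnouncesWithin (suc (length edgeClasses + 2)) matchingAlgorithm G p ids x)
  -- Two rounds, one for directions and far ports and one for colours, lead every node to the start
  -- of the extension; the states agree by computation.
  correct = finish edgeClasses {2} {monochromatic} (λ v → refl) invariant-start

corollary1p3 : ∀ (c : ℕ) → 1 ≤ c →
    Σ[ A ∈ Algorithm ℚ ] ∃[ t ] FindsMaximalHalfIntegralMatching c 3 t A
corollary1p3 c _ =
  -- 57 rounds: two of set-up, one for each of the 54 classes, one for the output.
  matchingAlgorithm , suc (length edgeClasses + 2) ,
  λ G Δ≤3 p ids → Correctness.correct G Δ≤3 p ids
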